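{- For every BPPS instance, the value $$\hat k=\sum_{c\in\mathcal C}\overline\beta_c$$ is an upper bound on the number of bins used in any optimal BPPS solution, where, for each class $c\in\mathcal C$, $\overline\beta_c$ denotes an (arbitrary) upper bound on the minimum number of bins of capacity $d-s_c$ required to pack all items of $\mathcal I_c$.
   Context: Bin Packing Problem with Setups (BPPS). An instance consists of: a bin capacity $d\in\mathbb Z_{\ge1}$; items $\mathcal I=\{1,\dots,n\}$ with weights $w_i\in\mathbb Z_{\ge1}$; classes $\mathcal C=\{1,\dots,m\}$ and a partition $\{\mathcal I_1,\dots,\mathcal I_m\}$ of $\mathcal I$ into (nonempty) classes; for each class $c$ a setup weight $s_c\in\mathbb Z_{\ge0}$ and a setup cost $f_c\in\mathbb Z_{\ge0}$; a bin cost $r\in\mathbb Z_{\ge1}$. It is assumed that $w_i+s_c\le d$ for all $c\in\mathcal C$, $i\in\mathcal I_c$, and that the items cannot all be packed in a single bin, i.e. $\sum_{i\in\mathcal I}w_i+\sum_{c\in\mathcal C}s_c>d$. For $S\subseteq\mathcal I$ let $\mathcal C(S)=\{c\in\mathcal C: S\cap\mathcal I_c\neq\emptyset\}$. A packing pattern is a subset $S\subseteq\mathcal I$ with $\sum_{i\in S}w_i+\sum_{c\in\mathcal C(S)}s_c\le d$. A feasible solution is a partition $\mathcal S$ of $\mathcal I$ into (nonempty) packing patterns; the number of bins it uses is $|\mathcal S|$ and its cost is $r|\mathcal S|+\sum_{S\in\mathcal S}\sum_{c\in\mathcal C(S)}f_c$. An optimal BPPS solution is a feasible solution of minimum cost.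 The minimum number of bins of capacity $d-s_c$ required to pack all items of $\mathcal I_c$ is the classical bin packing optimum: the minimum number of parts in a partition of $\mathcal I_c$ into subsets each of total weight at most $d-s_c$. -}

module Defs where

open import Algebra.Properties.CommutativeMonoid.Sum using (sum)
open import Data.Bool.Base using (if_then_else_)
open import Data.Fin.Base using (Fin)
open import Data.Fin.Subset using (Subset; _∈_; _∩_; ⊤; Nonempty; Empty)
open import Data.Fin.Subset.Properties using (nonempty?)
open import Data.Nat.Base using (ℕ; _+_; _*_; _∸_; _≤_; _<_)
open import Data.Nat.Properties using (+-0-commutativeMonoid)
open import Data.Product.Base using (_×_; ∃; ∃-syntax)
open import Data.Vec.Base using (lookup; tabulate)
open import Data.Vec.Functional using (Vector)
open import Function.Bundles using (_⇔_)
open import Relation.Binary.PropositionalEquality.Core using (_≢_)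
open import Relation.Nullary.Decidable.Core using (does)

∑ : ∀ {n} → Vector ℕ n → ℕ
∑ = sum +-0-commutativeMonoid

∑∈ : ∀ {n} → Subset n → Vector ℕ n → ℕ
∑∈ S f = ∑ λ i → if lookup S i then f i else 0

-- A partition is an indexed family; as its parts are nonempty and disjoint,
-- the family is injective, so k is the number of parts.
record IsPartition {n k} (T : Subset n) (P : Vector (Subset n) k) : Set where
  field
    nonempty : ∀ j → Nonempty (P j)
    disjoint : ∀ {i j} → i ≢ j → Empty (P i ∩ P j)
    covers   : ∀ x → x ∈ T ⇔ (∃[ j ] x ∈ P j)

IsMinimum : (ℕ → Set) → ℕ → Set
IsMinimum Q k = Q k × (∀ j → Q j → k ≤ j)

touchedClasses : ∀ {n m} → Vector (Subset n) m → Subset n → Subset m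
touchedClasses I S = tabulate λ c → does (nonempty? (S ∩ I c))

record BPPS : Set where
  field
    n m : ℕ
    d   : ℕ
    w   : Vector ℕ n
    I   : Vector (Subset n) m
    s f : Vector ℕ m
    r   : ℕ
    d-positive  : 1 ≤ d
    w-positive  : ∀ i → 1 ≤ w i
    r-positive  : 1 ≤ r
    I-partition : IsPartition ⊤ I
    item-fits   : ∀ c i → i ∈ I c → w i + s c ≤ d
    no-single-bin : d < ∑ w + ∑ s

  𝓒 : Subset n → Subset m
  𝓒 = touchedClasses I

  IsPattern : Subset n → Set
  IsPattern S = ∑∈ S w + ∑∈ (𝓒 S) s ≤ d

  IsFeasible : ∀ {k} → Vector (Subset n) k → Set
  IsFeasible 𝓢 = IsPartition ⊤ 𝓢 × (∀ j → IsPattern (𝓢 j))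

  cost : ∀ {k} → Vector (Subset n) k → ℕ
  cost {k} 𝓢 = r * k + ∑ λ j → ∑∈ (𝓒 (𝓢 j)) f

  IsOptimal : ∀ {k} → Vector (Subset n) k → Set
  IsOptimal 𝓢 =
    IsFeasible 𝓢 × (∀ {l} (𝓣 : Vector (Subset n) l) → IsFeasible 𝓣 → cost 𝓢 ≤ cost 𝓣)

  -- Truncated subtraction is harmless: class c has an item, so s c ≤ d
  -- by item-fits.
  ClassPackableInto : Fin m → ℕ → Set
  ClassPackableInto c k =
    ∃ λ (P : Vector (Subset n) k) →
      IsPartition (I c) P × (∀ j → ∑∈ (P j) w ≤ d ∸ s c)

  IsMinClassBins : Fin m → ℕ → Set
  IsMinClassBins c = IsMinimum (ClassPackableInto c)

  -- The minimum exists for every class (by item-fits each item can be given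
  -- its own bin), so quantifying over it universally is not vacuous.
  BoundsMinClassBins : Fin m → ℕ → Set
  BoundsMinClassBins c b = ∀ k → IsMinClassBins c k → k ≤ b

{-# OPTIONS --safe #-}
module Submission where

-- Packing every class separately into its minimum number k c of bins gives a
-- feasible solution of cost r ∑ k + ∑ k c · f c.  In any feasible solution 𝓢,
-- restricting to class c the t c bins that touch c packs that class into bins
-- of capacity d ∸ s c, so k c ≤ t c, while the cost of 𝓢 is
-- r |𝓢| + ∑ t c · f c.  Optimality of 𝓢 therefore forces |𝓢| ≤ ∑ k.

open import Defs
open import Algebra.Properties.CommutativeMonoid.Sum using (∑-comm)
open import Algebra.Properties.Monoid.Sum using (sum-cong-≗)
open import Algebra.Properties.Semiring.Sum using (*-distribʳ-sum)
open import Data.Bool.Base using (true; false; if_then_else_)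
open import Data.Fin.Base using (Fin; zero; suc; splitAt)
open import Data.Fin.Properties using (+↔⊎; sequence)
  renaming (_≟_ to _≟ᶠ_)
open import Data.Fin.Subset
  using (Subset; _∈_; _∩_; _⊆_; ⁅_⁆; ⊥; Nonempty)
open import Data.Fin.Subset.Properties
  using (nonempty?; x∈p∩q⁺; x∈p∩q⁻; x∈⁅x⁆; x∈⁅y⁆⇒x≡y; ∈⊤; drop-∷-⊆; p∩q⊆p; p∩q⊆q)
open import Data.Nat.Base using (ℕ; zero; suc; _+_; _*_; _∸_; _≤_; _<_; z≤n; >-nonZero)
open import Data.Nat.Induction using (<-rec)
open import Data.Nat.Properties
open import Data.Product.Base using (Σ; _,_; proj₁; proj₂; ∃; ∃-syntax)
open import Data.Sum.Base as Sum using (_⊎_; inj₁; inj₂)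
open import Data.Sum.Function.Propositional using (_⊎-↔_)
open import Data.Vec.Base using ([]; _∷_; lookup; here)
open import Data.Vec.Functional using (Vector)
open import Data.Vec.Properties using (lookup∘tabulate; []=⇒lookup; lookup⇒[]=)
open import Effect.Monad using (RawMonad)
open import Function.Base using (_∘_; id)
open import Function.Bundles using (Inverse; Equivalence; _↔_; mk↔ₛ′; mk⇔)
open import Function.Construct.Composition using (_↔-∘_)
open import Function.Construct.Identity using (↔-id)
open import Relation.Binary.PropositionalEquality
  using (_≡_; refl; sym; trans; cong; cong₂; subst; module ≡-Reasoning)
open import Relation.Nullary using (¬_; yes)
open import Relation.Nullary.Decidable using (decidable-stable; does; dec-true)
open import Relation.Nullary.Negation using (¬¬-Monad)

-- Sums over finite index sets and over subsets.

∑-mono-≤ : ∀ {n} {g h : Vector ℕ n} → (∀ i → g i ≤ h i) → ∑ g ≤ ∑ h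
∑-mono-≤ {zero}  g≤h = z≤n
∑-mono-≤ {suc n} g≤h = +-mono-≤ (g≤h zero) (∑-mono-≤ (g≤h ∘ suc))

∑-cong : ∀ {n} {g h : Vector ℕ n} → (∀ i → g i ≡ h i) → ∑ g ≡ ∑ h
∑-cong = sum-cong-≗ +-0-monoid

∑-const : ∀ n x → ∑ {n} (λ _ → x) ≡ n * x
∑-const zero    x = refl
∑-const (suc n) x = cong (x +_) (∑-const n x)

∑-splitAt : ∀ a {b} (h : Fin a ⊎ Fin b → ℕ) →
            ∑ (h ∘ splitAt a) ≡ ∑ (h ∘ inj₁) + ∑ (h ∘ inj₂)
∑-splitAt zero    h = refl
∑-splitAt (suc a) h =
  trans (cong (h (inj₁ zero) +_) (∑-splitAt a (h ∘ Sum.map suc id)))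
        (sym (+-assoc (h (inj₁ zero)) _ _))

∑∈-mono-⊆ : ∀ {n} {S T : Subset n} (g : Vector ℕ n) → S ⊆ T → ∑∈ S g ≤ ∑∈ T g
∑∈-mono-⊆ {S = []}        {[]}    g S⊆T = z≤n
∑∈-mono-⊆ {S = false ∷ S} {_ ∷ T} g S⊆T =
  +-mono-≤ z≤n (∑∈-mono-⊆ (g ∘ suc) (drop-∷-⊆ S⊆T))
-- Matching on `here` forces the head of the larger set to be `true`.
∑∈-mono-⊆ {S = true ∷ S}  {_ ∷ T} g S⊆T with S⊆T here
... | here = +-monoʳ-≤ (g zero) (∑∈-mono-⊆ (g ∘ suc) (drop-∷-⊆ S⊆T))

∑∈-⊥ : ∀ {n} (g : Vector ℕ n) → ∑∈ ⊥ g ≡ 0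
∑∈-⊥ {zero}  g = refl
∑∈-⊥ {suc n} g = ∑∈-⊥ (g ∘ suc)

∑∈-⁅⁆ : ∀ {n} (i : Fin n) (g : Vector ℕ n) → ∑∈ ⁅ i ⁆ g ≡ g i
∑∈-⁅⁆ zero    g = trans (cong (g zero +_) (∑∈-⊥ (g ∘ suc))) (+-identityʳ (g zero))
∑∈-⁅⁆ (suc i) g = ∑∈-⁅⁆ i (g ∘ suc)

member≤∑∈ : ∀ {n} {S : Subset n} {i} (g : Vector ℕ n) → i ∈ S → g i ≤ ∑∈ S g
member≤∑∈ {S = S} {i} g i∈S =
  subst (_≤ ∑∈ S g) (∑∈-⁅⁆ i g)
    (∑∈-mono-⊆ g λ x∈⁅i⁆ → subst (_∈ S) (sym (x∈⁅y⁆⇒x≡y i x∈⁅i⁆)) i∈S)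

-- Flattening dependent pairs into one finite index set.

Σ-suc-↔ : ∀ {m} (K : Vector ℕ (suc m)) →
          (Fin (K zero) ⊎ Σ (Fin m) (Fin ∘ K ∘ suc)) ↔ Σ (Fin (suc m)) (Fin ∘ K)
Σ-suc-↔ K = mk↔ₛ′
  (λ { (inj₁ j) → zero , j ; (inj₂ (c , j)) → suc c , j })
  (λ { (zero , j) → inj₁ j ; (suc c , j) → inj₂ (c , j) })
  (λ { (zero , j) → refl ; (suc c , j) → refl })
  (λ { (inj₁ j) → refl ; (inj₂ (c , j)) → refl })

-- Makes one vector out of a family with `K c` entries for each `c`. With 0/1-valued `K` it
-- enumerates a subset instead.
∑↔Σ : ∀ {m} (K : Vector ℕ m) → Fin (∑ K) ↔ Σ (Fin m) (Fin ∘ K)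
∑↔Σ {zero}  K = mk↔ₛ′ (λ ()) (λ ()) (λ ()) (λ ())
∑↔Σ {suc m} K = Σ-suc-↔ K ↔-∘ ((↔-id _ ⊎-↔ ∑↔Σ (K ∘ suc)) ↔-∘ +↔⊎)

-- The first `K zero` positions all contribute `g zero`; the remaining ones follow by induction.
∑-over-∑↔Σ : ∀ {m} (K : Vector ℕ m) (g : Fin m → ℕ) →
             ∑ (g ∘ proj₁ ∘ Inverse.to (∑↔Σ K)) ≡ ∑ λ c → K c * g c
∑-over-∑↔Σ {zero}  K g = refl
∑-over-∑↔Σ {suc m} K g =
  trans (∑-splitAt (K zero) (g ∘ proj₁ ∘ Inverse.to (Σ-suc-↔ K)
                               ∘ Sum.map id (Inverse.to (∑↔Σ (K ∘ suc)))))
        (cong₂ _+_ (∑-const (K zero) (g zero)) (∑-over-∑↔Σ (K ∘ suc) (g ∘ suc)))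

-- Disjointness is asked for as uniqueness of the part containing `x`, which is easy to check for
-- pair indices; injectivity of `π` carries it over to `Fin l`.
reindexed-partition :
  ∀ {n l} {A : Set} {T : Subset n} (P : A → Subset n) (π : Fin l ↔ A) →
  (∀ a → Nonempty (P a)) →
  (∀ {a b x} → x ∈ P a → x ∈ P b → a ≡ b) →
  (∀ {a} → P a ⊆ T) →
  (∀ {x} → x ∈ T → ∃[ a ] x ∈ P a) →
  IsPartition T (P ∘ Inverse.to π)
reindexed-partition P π nonempty unique inside covered = record
  { nonempty = nonempty ∘ to
  ; disjoint = λ { i≢j (x , x∈) → let x∈i , x∈j = x∈p∩q⁻ _ _ x∈ in
      i≢j (trans (sym (strictlyInverseʳ _))
          (trans (cong from (unique x∈i x∈j)) (strictlyInverseʳ _))) }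
  ; covers   = λ x → mk⇔
      (λ x∈T → let a , x∈Pa = covered x∈T in
        from a , subst (λ b → x ∈ P b) (sym (strictlyInverseˡ a)) x∈Pa)
      (λ { (j , x∈) → inside x∈ })
  }
  where open Inverse π

-- Membership in parts, touched classes and indicators.

module _ {n k} {T : Subset n} {P : Vector (Subset n) k} (part : IsPartition T P) where
  open IsPartition part

  -- Equality on `Fin` is decidable, so the negative `disjoint` yields an equation.
  part-unique : ∀ {i j x} → x ∈ P i → x ∈ P j → i ≡ j
  part-unique {i} {j} x∈i x∈j =
    decidable-stable (i ≟ᶠ j) λ i≢j → disjoint i≢j (_ , x∈p∩q⁺ (x∈i , x∈j))

  part-⊆ : ∀ {j} → P j ⊆ T
  part-⊆ x∈ = Equivalence.from (covers _) (_ , x∈)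

  part-of : ∀ {x} → x ∈ T → ∃[ j ] x ∈ P j
  part-of = Equivalence.to (covers _)

module _ {n m} (I : Vector (Subset n) m) {S : Subset n} where

  touched⁺ : ∀ {c} → Nonempty (S ∩ I c) → c ∈ touchedClasses I S
  touched⁺ {c} S∩Ic =
    lookup⇒[]= c _ (trans (lookup∘tabulate _ c) (dec-true (nonempty? (S ∩ I c)) S∩Ic))

  touched⁻ : ∀ {c} → c ∈ touchedClasses I S → Nonempty (S ∩ I c)
  -- Abstracting the equation along with the decision turns it into `false ≡ true` in the negative
  -- case, which is then absurd.
  touched⁻ {c} c∈ with nonempty? (S ∩ I c)
                     | trans (sym (lookup∘tabulate (λ c → does (nonempty? (S ∩ I c))) c))
                             ([]=⇒lookup c∈)
  ... | yes S∩Ic | _ = S∩Ic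

-- Numeric, so that it both counts under `∑` and gives a type `Fin (indicator S i)` that acts as a
-- proof-irrelevant form of `i ∈ S`.
indicator : ∀ {n} → Subset n → Fin n → ℕ
indicator S i = if lookup S i then 1 else 0

indicator⁻ : ∀ {n} {S : Subset n} {i} → Fin (indicator S i) → i ∈ S
indicator⁻ {S = S} {i} p with lookup S i in eq
... | true = lookup⇒[]= i S eq

indicator⁺ : ∀ {n} {S : Subset n} {i} → i ∈ S → Fin (indicator S i)
indicator⁺ i∈S rewrite []=⇒lookup i∈S = zero

indicator-irrelevant : ∀ {n} (S : Subset n) i (p q : Fin (indicator S i)) → p ≡ q
indicator-irrelevant S i p q with lookup S i
indicator-irrelevant S i zero zero | true = refl

∑∈-indicator : ∀ {n} (S : Subset n) (g : Vector ℕ n) →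
               ∑∈ S g ≡ ∑ λ i → indicator S i * g i
∑∈-indicator S g = ∑-cong λ i → scaled (lookup S i) (g i)
  where
  scaled : ∀ b x → (if b then x else 0) ≡ (if b then 1 else 0) * x
  scaled true  x = sym (+-identityʳ x)
  scaled false x = refl

-- For an undecided predicate the minimum exists only up to double negation,
-- which suffices for proving a decidable goal.
¬¬-minimum : (Q : ℕ → Set) → ∀ {k} → Q k → ¬ ¬ ∃ (IsMinimum Q)
¬¬-minimum Q {k} Qk no-minimum = <-rec (¬_ ∘ Q) step k Qk
  where
  step : ∀ i → (∀ {j} → j < i → ¬ Q j) → ¬ Q i
  step i none-below Qi =
    no-minimum (i , Qi , λ j Qj → ≮⇒≥ λ j<i → none-below j<i Qj)

-- Feasible solutions and packings of single classes.

module _ (B : BPPS) where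
  open BPPS B

  setup≤capacity : ∀ c → s c ≤ d
  setup≤capacity c = let i , i∈Ic = IsPartition.nonempty I-partition c in
    ≤-trans (m≤n+m (s c) (w i)) (item-fits c i i∈Ic)

  module _ {c} {S : Subset n} (S⊆Ic : S ⊆ I c) where

    -- A subset of `I c` touches no class but `c`. The inequality also covers empty `S`, where the
    -- sum is 0.
    ∑∈-𝓒-single : ∀ g → ∑∈ (𝓒 S) g ≤ g c
    ∑∈-𝓒-single g = subst (∑∈ (𝓒 S) g ≤_) (∑∈-⁅⁆ c g) (∑∈-mono-⊆ g 𝓒S⊆⁅c⁆)
      where
      𝓒S⊆⁅c⁆ : 𝓒 S ⊆ ⁅ c ⁆
      𝓒S⊆⁅c⁆ {c′} c′∈ =
        let x , x∈ = touched⁻ I c′∈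
            x∈S , x∈Ic′ = x∈p∩q⁻ S (I c′) x∈
        in subst (_∈ ⁅ c ⁆) (part-unique I-partition (S⊆Ic x∈S) x∈Ic′) (x∈⁅x⁆ c)

    pattern-of-class : ∑∈ S w ≤ d ∸ s c → IsPattern S
    pattern-of-class fits =
      ≤-trans (+-monoʳ-≤ (∑∈ S w) (∑∈-𝓒-single s))
              (m≤o∸n⇒m+n≤o (∑∈ S w) (setup≤capacity c) fits)

  -- As `c` is touched, `s c` is among the setups counted in the pattern, so the items share at most
  -- `d ∸ s c`.
  pattern-restricted : ∀ {S c} → IsPattern S → c ∈ 𝓒 S → ∑∈ (S ∩ I c) w ≤ d ∸ s c
  pattern-restricted {S} {c} fits c∈ = m+n≤o⇒m≤o∸n (∑∈ (S ∩ I c) w)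
    (≤-trans (+-mono-≤ (∑∈-mono-⊆ w (p∩q⊆p S (I c))) (member≤∑∈ s c∈)) fits)

  module Classwise (K : Vector ℕ m) (packings : ∀ c → ClassPackableInto c (K c)) where

    bin : Σ (Fin m) (Fin ∘ K) → Subset n
    bin (c , j) = proj₁ (packings c) j

    private
      partition : ∀ c → IsPartition (I c) (proj₁ (packings c))
      partition c = proj₁ (proj₂ (packings c))

      bin-⊆ : ∀ a → bin a ⊆ I (proj₁ a)
      bin-⊆ (c , j) = part-⊆ (partition c)

      bin-unique : ∀ {a b x} → x ∈ bin a → x ∈ bin b → a ≡ b
      bin-unique {c , i} {c′ , j} x∈ x∈′
        -- A common item first identifies the classes; only then are both bins parts of the same
        -- partition.
        with refl ← part-unique I-partition (bin-⊆ (c , i) x∈) (bin-⊆ (c′ , j) x∈′)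
        = cong (c ,_) (part-unique (partition c) x∈ x∈′)

    solution : Vector (Subset n) (∑ K)
    solution = bin ∘ Inverse.to (∑↔Σ K)

    solution-feasible : IsFeasible solution
    solution-feasible =
      reindexed-partition bin (∑↔Σ K)
        (λ { (c , j) → IsPartition.nonempty (partition c) j })
        bin-unique
        (λ _ → ∈⊤)
        (λ x∈ → let c , x∈Ic = part-of I-partition x∈
                    j , x∈P  = part-of (partition c) x∈Ic
                in (c , j) , x∈P) ,
      λ i → let c , j = Inverse.to (∑↔Σ K) i in
        pattern-of-class (bin-⊆ (c , j)) (proj₂ (proj₂ (packings c)) j)

    cost-solution : cost solution ≤ r * ∑ K + ∑ λ c → K c * f c
    cost-solution = +-monoʳ-≤ (r * ∑ K) (begin
      ∑ (λ i → ∑∈ (𝓒 (solution i)) f)        ≤⟨ ∑-mono-≤ (λ i → ∑∈-𝓒-single (bin-⊆ (Inverse.to (∑↔Σ K) i)) f) ⟩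
      ∑ (f ∘ proj₁ ∘ Inverse.to (∑↔Σ K))     ≡⟨ ∑-over-∑↔Σ K f ⟩
      ∑ (λ c → K c * f c)                    ∎)
      where open ≤-Reasoning

  module Touching {k} (𝓢 : Vector (Subset n) k) where

    touchCount : Vector ℕ m
    touchCount c = ∑ λ j → indicator (𝓒 (𝓢 j)) c

    -- Double counting: `f c` is paid once for each bin that touches `c`.
    cost-by-class : cost 𝓢 ≡ r * k + ∑ λ c → touchCount c * f c
    cost-by-class = cong (r * k +_) (begin
      ∑ (λ j → ∑∈ (𝓒 (𝓢 j)) f)                          ≡⟨ ∑-cong (λ j → ∑∈-indicator (𝓒 (𝓢 j)) f) ⟩
      ∑ (λ j → ∑ λ c → indicator (𝓒 (𝓢 j)) c * f c)     ≡⟨ ∑-comm +-0-commutativeMonoid (λ j c → indicator (𝓒 (𝓢 j)) c * f c) ⟩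
      ∑ (λ c → ∑ λ j → indicator (𝓒 (𝓢 j)) c * f c)     ≡⟨ ∑-cong (λ c → *-distribʳ-sum +-*-semiring (f c) (λ j → indicator (𝓒 (𝓢 j)) c)) ⟨
      ∑ (λ c → touchCount c * f c)                       ∎)
      where open ≡-Reasoning

    -- The parts are the bins cut down to `I c`. Indexing only by touching bins keeps the parts
    -- nonempty and guarantees that each has reserved `s c`.
    restriction-packs : IsFeasible 𝓢 → ∀ c → ClassPackableInto c (touchCount c)
    restriction-packs (partition , patterns) c =
      restricted ∘ Inverse.to π ,
      reindexed-partition restricted π
        (λ { (j , p) → touched⁻ I (indicator⁻ p) })
        unique
        (p∩q⊆q _ (I c))
        (λ x∈Ic → let j , x∈ = part-of partition ∈⊤
                      x∈∩    = x∈p∩q⁺ (x∈ , x∈Ic)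
                  in (j , indicator⁺ (touched⁺ I (_ , x∈∩))) , x∈∩) ,
      λ i → let j , p = Inverse.to π i in pattern-restricted (patterns j) (indicator⁻ p)
      where
      touching : Vector ℕ k
      touching j = indicator (𝓒 (𝓢 j)) c

      π = ∑↔Σ touching

      restricted : Σ (Fin k) (Fin ∘ touching) → Subset n
      restricted (j , _) = 𝓢 j ∩ I c

      unique : ∀ {a b x} → x ∈ restricted a → x ∈ restricted b → a ≡ b
      unique {i , p} {j , q} x∈ x∈′
        with refl ← part-unique partition (p∩q⊆p _ (I c) x∈) (p∩q⊆p _ (I c) x∈′)
        = cong (i ,_) (indicator-irrelevant (𝓒 (𝓢 i)) c p q)

  bins≤∑minima : ∀ {k} (𝓢 : Vector (Subset n) k) → IsOptimal 𝓢 →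
                 (K : Vector ℕ m) → (∀ c → IsMinClassBins c (K c)) → k ≤ ∑ K
  bins≤∑minima {k} 𝓢 (feasible , optimal) K minimal =
    -- Bounding `K` by `touchCount` gives both ends the same setup sum; cancelling it and then `r`
    -- leaves the bin counts.
    *-cancelˡ-≤ r {{>-nonZero r-positive}}
      (+-cancelʳ-≤ (∑ λ c → touchCount c * f c) (r * k) (r * ∑ K) (begin
        r * k + ∑ (λ c → touchCount c * f c)     ≡⟨ cost-by-class ⟨
        cost 𝓢                                   ≤⟨ optimal solution solution-feasible ⟩
        cost solution                            ≤⟨ cost-solution ⟩
        r * ∑ K + ∑ (λ c → K c * f c)            ≤⟨ +-monoʳ-≤ (r * ∑ K) (∑-mono-≤ λ c → *-monoˡ-≤ (f c) (K≤touchCount c)) ⟩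
        r * ∑ K + ∑ (λ c → touchCount c * f c)   ∎))
    where
    open ≤-Reasoning
    open Touching 𝓢
    open Classwise K (λ c → proj₁ (minimal c))

    K≤touchCount : ∀ c → K c ≤ touchCount c
    -- Minimality is tested against the packing that `𝓢` itself induces.
    K≤touchCount c = proj₂ (minimal c) (touchCount c) (restriction-packs feasible c)

proposition10 : (B : BPPS) → let open BPPS B in
    (β : Vector ℕ m) → (∀ c → BoundsMinClassBins c (β c)) →
    ∀ {k} (𝓢 : Vector (Subset n) k) → IsOptimal 𝓢 → k ≤ ∑ β
proposition10 B β bounds {k} 𝓢 optimal@(feasible , _) =
  decidable-stable (k ≤? ∑ β) (RawMonad._<$>_ ¬¬-Monad conclude ¬¬minima)
  where
  open BPPS B

  ¬¬minima : ¬ ¬ (∀ c → ∃ (IsMinClassBins c))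
  -- Double negation commutes with a quantifier over finitely many classes.
  ¬¬minima = sequence (RawMonad.rawApplicative ¬¬-Monad) λ c →
    -- The search for a minimum needs some packing to start from; `𝓢` supplies it.
    ¬¬-minimum (ClassPackableInto c) (Touching.restriction-packs B 𝓢 feasible c)

  conclude : (∀ c → ∃ (IsMinClassBins c)) → k ≤ ∑ β
  conclude minima = ≤-trans
    (bins≤∑minima B 𝓢 optimal (proj₁ ∘ minima) (proj₂ ∘ minima))
    (∑-mono-≤ λ c → bounds c _ (proj₂ (minima c)))
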